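{- The formula $\mathit{Uniq}$, namely $$\mathit{Uniq}:\qquad \bigwedge_{\mathcal{S}'\ne\mathcal{S}''}\lnot(\epsilon_{\mathcal{S}'}\land\epsilon_{\mathcal{S}''}),$$ where the conjunction ranges over all pairs of distinct full Sudoku grids $\mathcal{S}',\mathcal{S}''$, is an axiom of the deductive system of Sudoku logic, that is, $\mathit{Uniq}\in\Delta_{ax}$.
   Context: A Sudoku proposition is a formal symbol $r_ic_j \not\approx d$ with $i,j,d\in\{1,\dots,9\}$. Sudoku formulas are built inductively from Sudoku propositions and the constants $\top,\bot$ using $\lnot,\land,\lor,\Rightarrow,\Leftrightarrow$. A grid is a $9\times 9$ matrix $\mathcal{A}=[A_{ij}]_{9\times 9}$ of nonempty subsets $A_{ij}\subseteq\{1,\dots,9\}$; it is full if $|A_{ij}|=1$ for all $i,j$. Satisfaction $\mathcal{A}\models\phi$: $\mathcal{A}\models\top$ always, $\mathcal{A}\models\bot$ never, $\mathcal{A}\models r_ic_j\not\approx d$ iff $d\notin A_{ij}$, and the connectives are interpreted classically. A Sudoku grid is a grid such that whenever $A_{ij}=\{d\}$, the digit $d$ belongs to no $A_{\ell m}$ for any other cell in the same row, column or (standard $3\times 3$) box; a full Sudoku grid is a Sudoku grid that is full. There are finitely many full Sudoku grids. A Sudoku axiom is a Sudoku formula that holds in every full Sudoku grid; $\Delta_{ax}$ is the set of all Sudoku axioms. Write $r_ic_j\approx d$ for $\lnot(r_ic_j\not\approx d)$. For a full Sudoku grid $\mathcal{S}=[S_{ij}]_{9\times 9}$ with $S_{ij}=\{d_{ij}\}$,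 let $\epsilon_{\mathcal{S}}$ be the formula $\bigwedge_{1\le i,j\le 9} r_ic_j\approx d_{ij}$. -}

module Defs where

open import Data.Bool.Base using (true; false)
open import Data.Bool.Properties using () renaming (_≟_ to _≟ᵇ_)
open import Data.Empty using (⊥; ⊥-elim-irr)
open import Data.Fin.Base using (Fin; zero; suc; toℕ)
open import Data.Fin.Properties using (all?) renaming (_≟_ to _≟ᶠ_)
open import Data.Fin.Subset using (Subset; inside; outside; ⁅_⁆; _∉_; ∣_∣; Nonempty) renaming (⊥ to ∅)
open import Data.Fin.Subset.Properties using (_∈?_; nonempty?)
open import Data.List.Base
  using (List; []; _∷_; foldr; map; filter; mapMaybe; allFin; cartesianProduct; cartesianProductWith)
open import Data.List.Membership.Propositional using (_∈_)
open import Data.List.Membership.Propositional.Properties using (∈-cartesianProductWith⁺)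
open import Data.List.Relation.Unary.Any using (here; there)
open import Data.Maybe.Base using (Maybe; just; nothing)
open import Data.Nat.Base using (ℕ; zero; suc; _/_)
open import Data.Nat.Properties using (suc-injective) renaming (_≟_ to _≟ⁿ_)
open import Data.Product.Base using (_×_; _,_)
open import Data.Sum.Base using (_⊎_)
open import Data.Unit.Base using (⊤; tt)
open import Data.Vec.Base using (Vec; []; _∷_; lookup)
open import Data.Vec.Properties using () renaming (≡-dec to Vec-≡-dec)
open import Level using (0ℓ)
open import Relation.Binary.Definitions using (DecidableEquality)
open import Relation.Binary.PropositionalEquality using (_≡_; refl; cong)
open import Relation.Nullary.Decidable
  using (Dec; yes; no; ¬?; map′; _×-dec_; _⊎-dec_; _→-dec_)
open import Relation.Nullary.Negation using (¬_)
open import Relation.Unary using (Pred)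

-- Rows, columns and digits 1,…,9 are all represented by Fin 9 (that is, 0,…,8).

infix 20 r_c_≉_ r_c_≈_

data Proposition : Set where
  r_c_≉_ : (i j d : Fin 9) → Proposition

infix  9 ¬ᶠ_
infixr 8 _∧ᶠ_
infixr 7 _∨ᶠ_
infixr 6 _⇒ᶠ_
infix  5 _⇔ᶠ_

data Formula : Set where
  prop                      : Proposition → Formula
  ⊤ᶠ ⊥ᶠ                     : Formula
  ¬ᶠ_                       : Formula → Formula
  _∧ᶠ_ _∨ᶠ_ _⇒ᶠ_ _⇔ᶠ_       : Formula → Formula → Formula

r_c_≈_ : (i j d : Fin 9) → Formula
r i c j ≈ d = ¬ᶠ prop (r i c j ≉ d)

⋀ : List Formula → Formula
⋀ = foldr _∧ᶠ_ ⊤ᶠ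

-- The proof field is irrelevant, so two grids are equal as soon as
-- their underlying matrices are.
record Grid : Set where
  constructor mkGrid
  field
    cells     : Vec (Vec (Subset 9) 9) 9
    .nonempty : ∀ i j → Nonempty (lookup (lookup cells i) j)

open Grid public using (cells)

_[_,_] : Grid → Fin 9 → Fin 9 → Subset 9
𝒜 [ i , j ] = lookup (lookup (cells 𝒜) i) j

-- Every formula is decided in every grid (see _⊨?_), so reading the connectives
-- through those of the metalanguage gives the classical truth tables.
infix 4 _⊨_ _⊨?_

_⊨_ : Grid → Formula → Set
𝒜 ⊨ prop (r i c j ≉ d) = d ∉ 𝒜 [ i , j ]
𝒜 ⊨ ⊤ᶠ                 = ⊤
𝒜 ⊨ ⊥ᶠ                 = ⊥
𝒜 ⊨ ¬ᶠ φ               = ¬ (𝒜 ⊨ φ)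
𝒜 ⊨ φ ∧ᶠ ψ             = (𝒜 ⊨ φ) × (𝒜 ⊨ ψ)
𝒜 ⊨ φ ∨ᶠ ψ             = (𝒜 ⊨ φ) ⊎ (𝒜 ⊨ ψ)
𝒜 ⊨ φ ⇒ᶠ ψ             = 𝒜 ⊨ φ → 𝒜 ⊨ ψ
𝒜 ⊨ φ ⇔ᶠ ψ             = (𝒜 ⊨ φ → 𝒜 ⊨ ψ) × (𝒜 ⊨ ψ → 𝒜 ⊨ φ)

_⊨?_ : ∀ 𝒜 φ → Dec (𝒜 ⊨ φ)
𝒜 ⊨? prop (r i c j ≉ d) = ¬? (d ∈? 𝒜 [ i , j ])
𝒜 ⊨? ⊤ᶠ                 = yes tt
𝒜 ⊨? ⊥ᶠ                 = no λ ()
𝒜 ⊨? ¬ᶠ φ               = ¬? (𝒜 ⊨? φ)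
𝒜 ⊨? φ ∧ᶠ ψ             = (𝒜 ⊨? φ) ×-dec (𝒜 ⊨? ψ)
𝒜 ⊨? φ ∨ᶠ ψ             = (𝒜 ⊨? φ) ⊎-dec (𝒜 ⊨? ψ)
𝒜 ⊨? φ ⇒ᶠ ψ             = (𝒜 ⊨? φ) →-dec (𝒜 ⊨? ψ)
𝒜 ⊨? φ ⇔ᶠ ψ             = ((𝒜 ⊨? φ) →-dec (𝒜 ⊨? ψ)) ×-dec ((𝒜 ⊨? ψ) →-dec (𝒜 ⊨? φ))

SameBox : (i j l m : Fin 9) → Set
SameBox i j l m = (toℕ i / 3 ≡ toℕ l / 3) × (toℕ j / 3 ≡ toℕ m / 3)

Peers : (i j l m : Fin 9) → Set
Peers i j l m = ¬ (i ≡ l × j ≡ m) × (i ≡ l ⊎ j ≡ m ⊎ SameBox i j l m)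

IsSudoku : Grid → Set
IsSudoku 𝒜 = ∀ i j d → 𝒜 [ i , j ] ≡ ⁅ d ⁆ → ∀ l m → Peers i j l m → d ∉ 𝒜 [ l , m ]

IsFull : Grid → Set
IsFull 𝒜 = ∀ i j → ∣ 𝒜 [ i , j ] ∣ ≡ 1

record FullSudokuGrid : Set where
  constructor mkFull
  field
    grid      : Grid
    .isSudoku : IsSudoku grid
    .isFull   : IsFull grid

open FullSudokuGrid public using (grid)

IsAxiom : Formula → Set
IsAxiom φ = ∀ (𝒮 : FullSudokuGrid) → grid 𝒮 ⊨ φ

Δax : Pred Formula 0ℓ
Δax = IsAxiom

-- The unique element of a one-element set.
the : ∀ {n} (p : Subset n) → .(∣ p ∣ ≡ 1) → Fin n
the (inside  ∷ p) _  = zero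
the (outside ∷ p) eq = suc (the p eq)

∣p∣≡0⇒p≡∅ : ∀ {n} {p : Subset n} → ∣ p ∣ ≡ 0 → p ≡ ∅
∣p∣≡0⇒p≡∅ {p = []}          _  = refl
∣p∣≡0⇒p≡∅ {p = outside ∷ p} eq = cong (outside ∷_) (∣p∣≡0⇒p≡∅ eq)

⁅the⁆ : ∀ {n} (p : Subset n) (eq : ∣ p ∣ ≡ 1) → p ≡ ⁅ the p eq ⁆
⁅the⁆ (inside  ∷ p) eq = cong (inside ∷_) (∣p∣≡0⇒p≡∅ (suc-injective eq))
⁅the⁆ (outside ∷ p) eq = cong (outside ∷_) (⁅the⁆ p eq)

digit : FullSudokuGrid → Fin 9 → Fin 9 → Fin 9
digit (mkFull 𝒜 _ full) i j = the (𝒜 [ i , j ]) (full i j)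

ε : FullSudokuGrid → Formula
ε 𝒮 = ⋀ (map (λ (i , j) → r i c j ≈ digit 𝒮 i j) (cartesianProduct (allFin 9) (allFin 9)))

-- Enumeration of the full Sudoku grids, by filtering all 9 × 9 matrices of subsets.

-- The opaque blocks serve only to keep the typechecker from computing these lists.
opaque
  vectors : ∀ {A : Set} → List A → ∀ n → List (Vec A n)
  vectors xs zero    = [] ∷ []
  vectors xs (suc n) = cartesianProductWith _∷_ xs (vectors xs n)

  ∈-vectors : ∀ {A : Set} {xs : List A} → (∀ x → x ∈ xs) → ∀ {n} (v : Vec A n) → v ∈ vectors xs n
  ∈-vectors all∈ []      = here refl
  ∈-vectors all∈ (x ∷ v) = ∈-cartesianProductWith⁺ _∷_ (all∈ x) (∈-vectors all∈ v)

matrices : List (Vec (Vec (Subset 9) 9) 9)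
matrices = vectors (vectors (vectors (true ∷ false ∷ []) 9) 9) 9

∈-matrices : ∀ M → M ∈ matrices
∈-matrices = ∈-vectors (∈-vectors (∈-vectors λ where
  true  → here refl
  false → there (here refl)))

infix 4 _≟ˢ_ _≟_

_≟ˢ_ : DecidableEquality (Subset 9)
_≟ˢ_ = Vec-≡-dec _≟ᵇ_

isSudoku? : ∀ 𝒜 → Dec (IsSudoku 𝒜)
isSudoku? 𝒜 =
  all? λ i → all? λ j → all? λ d → (𝒜 [ i , j ] ≟ˢ ⁅ d ⁆) →-dec
  (all? λ l → all? λ m → peers? i j l m →-dec ¬? (d ∈? 𝒜 [ l , m ]))
  where
  peers? : ∀ i j l m → Dec (Peers i j l m)
  peers? i j l m =
    ¬? ((i ≟ᶠ l) ×-dec (j ≟ᶠ m)) ×-dec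
    ((i ≟ᶠ l) ⊎-dec (j ≟ᶠ m) ⊎-dec
     ((toℕ i / 3 ≟ⁿ toℕ l / 3) ×-dec (toℕ j / 3 ≟ⁿ toℕ m / 3)))

isFull? : ∀ 𝒜 → Dec (IsFull 𝒜)
isFull? 𝒜 = all? λ i → all? λ j → ∣ 𝒜 [ i , j ] ∣ ≟ⁿ 1

fromGrid : ∀ 𝒜 → Dec (IsSudoku 𝒜) → Dec (IsFull 𝒜) → Maybe FullSudokuGrid
fromGrid 𝒜 (yes s) (yes f) = just (mkFull 𝒜 s f)
fromGrid 𝒜 (yes _) (no _)  = nothing
fromGrid 𝒜 (no _)  _       = nothing

fromGrid-full : ∀ 𝒜 .(s : IsSudoku 𝒜) .(f : IsFull 𝒜) s? f? → fromGrid 𝒜 s? f? ≡ just (mkFull 𝒜 s f)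
fromGrid-full 𝒜 s f (yes _) (yes _) = refl
fromGrid-full 𝒜 s f (yes _) (no ¬f) = ⊥-elim-irr (¬f f)
fromGrid-full 𝒜 s f (no ¬s) _       = ⊥-elim-irr (¬s s)

AllNonempty : Vec (Vec (Subset 9) 9) 9 → Set
AllNonempty M = ∀ i j → Nonempty (lookup (lookup M i) j)

allNonempty? : ∀ M → Dec (AllNonempty M)
allNonempty? M = all? λ i → all? λ j → nonempty? (lookup (lookup M i) j)

fromCells : ∀ M → Dec (AllNonempty M) → Maybe FullSudokuGrid
fromCells M (yes ne) = fromGrid (mkGrid M ne) (isSudoku? (mkGrid M ne)) (isFull? (mkGrid M ne))
fromCells M (no _)   = nothing

fromCells-full : ∀ 𝒮 ne? → fromCells (cells (grid 𝒮)) ne? ≡ just 𝒮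
fromCells-full (mkFull (mkGrid M _) s f) (yes ne) =
  fromGrid-full (mkGrid M ne) s f (isSudoku? (mkGrid M ne)) (isFull? (mkGrid M ne))
fromCells-full (mkFull (mkGrid M ne) s f) (no ¬ne) = ⊥-elim-irr (¬ne ne)

fromMatrix : Vec (Vec (Subset 9) 9) 9 → Maybe FullSudokuGrid
fromMatrix M = fromCells M (allNonempty? M)

fromMatrix-full : ∀ 𝒮 → fromMatrix (cells (grid 𝒮)) ≡ just 𝒮
fromMatrix-full 𝒮 = fromCells-full 𝒮 (allNonempty? (cells (grid 𝒮)))

∈-mapMaybe : ∀ {A B : Set} (f : A → Maybe B) {x y xs} → x ∈ xs → f x ≡ just y → y ∈ mapMaybe f xs
∈-mapMaybe f {x} (here refl) eq with f x | eq
... | just _ | refl = here refl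
∈-mapMaybe f {xs = z ∷ _} (there x∈) eq with f z
... | just _  = there (∈-mapMaybe f x∈ eq)
... | nothing = ∈-mapMaybe f x∈ eq

opaque
  fullSudokuGrids : List FullSudokuGrid
  fullSudokuGrids = mapMaybe fromMatrix matrices

  ∈-fullSudokuGrids : ∀ 𝒮 → 𝒮 ∈ fullSudokuGrids
  ∈-fullSudokuGrids 𝒮 =
    ∈-mapMaybe fromMatrix (∈-matrices (cells (grid 𝒮))) (fromMatrix-full 𝒮)

_≟_ : DecidableEquality FullSudokuGrid
mkFull (mkGrid M _) _ _ ≟ mkFull (mkGrid N _) _ _ =
  map′ (λ { refl → refl }) (cong (λ 𝒮 → cells (grid 𝒮))) (Vec-≡-dec (Vec-≡-dec _≟ˢ_) M N)

distinctPairs : List (FullSudokuGrid × FullSudokuGrid)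
distinctPairs =
  filter (λ (𝒮′ , 𝒮″) → ¬? (𝒮′ ≟ 𝒮″)) (cartesianProduct fullSudokuGrids fullSudokuGrids)

Uniq : Formula
Uniq = ⋀ (map (λ (𝒮′ , 𝒮″) → ¬ᶠ (ε 𝒮′ ∧ᶠ ε 𝒮″)) distinctPairs)

{-# OPTIONS --safe #-}
-- A full grid 𝒮 satisfying ε 𝒮′ contains the digit of 𝒮′ in every cell; as its cells are
-- singletons, 𝒮 = 𝒮′.  So no full grid satisfies both ε 𝒮′ and ε 𝒮″ unless 𝒮′ = 𝒮″.
module Submission where

open import Defs
open import Relation.Unary using (_∈_)

open import Data.Fin.Subset using (∣_∣; ⁅_⁆) renaming (_∈_ to _∈ˢ_)
open import Data.Fin.Subset.Properties using (_∈?_; x∈⁅y⁆⇒x≡y)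
open import Data.List.Base using ([]; _∷_; map; allFin; cartesianProduct)
open import Data.List.Membership.Propositional.Properties using (∈-allFin; ∈-cartesianProduct⁺)
open import Data.List.Relation.Unary.All as All using (All; []; _∷_)
open import Data.List.Relation.Unary.All.Properties using (all-filter)
open import Data.Nat.Properties using () renaming (_≟_ to _≟ⁿ_)
open import Data.Product.Base using (_,_)
open import Data.Unit.Base using (tt)
open import Data.Vec.Base using (Vec; lookup)
open import Data.Vec.Properties using (tabulate∘lookup; tabulate-cong)
open import Relation.Binary.PropositionalEquality
  using (_≡_; refl; sym; trans; cong; subst; module ≡-Reasoning)
open import Relation.Nullary.Decidable using (decidable-stable; recompute; ¬?)

-- The formula `ε 𝒮′` fixes a digit in each cell, so 𝒮′ is the only full Sudoku grid that can
-- satisfy it (`⊨ε⇒≡`). A grid satisfying both halves of a pair would force the two members to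
-- coincide, whereas `distinctPairs` keeps only unequal ones.

lookup-injective : ∀ {A : Set} {n} {u v : Vec A n} → (∀ i → lookup u i ≡ lookup v i) → u ≡ v
lookup-injective {u = u} {v} eq =
  trans (sym (tabulate∘lookup u)) (trans (tabulate-cong eq) (tabulate∘lookup v))

⊨-⋀-map⁺ : ∀ {A : Set} {𝒜} (f : A → Formula) {xs} →
           All (λ x → 𝒜 ⊨ f x) xs → 𝒜 ⊨ ⋀ (map f xs)
⊨-⋀-map⁺ f []       = tt
⊨-⋀-map⁺ f (p ∷ ps) = p , ⊨-⋀-map⁺ f ps

⊨-⋀-map⁻ : ∀ {A : Set} 𝒜 (f : A → Formula) xs →
           𝒜 ⊨ ⋀ (map f xs) → All (λ x → 𝒜 ⊨ f x) xs
⊨-⋀-map⁻ 𝒜 f []       _        = []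
⊨-⋀-map⁻ 𝒜 f (_ ∷ xs) (p , ps) = p ∷ ⊨-⋀-map⁻ 𝒜 f xs ps

-- Unfolded, `≈` is a double negation of membership, which decidability of membership removes.
⊨-≈⇒∈ : ∀ 𝒜 i j d → 𝒜 ⊨ r i c j ≈ d → d ∈ˢ 𝒜 [ i , j ]
⊨-≈⇒∈ 𝒜 i j d = decidable-stable (d ∈? 𝒜 [ i , j ])

cell≡⁅digit⁆ : ∀ 𝒮 i j → grid 𝒮 [ i , j ] ≡ ⁅ digit 𝒮 i j ⁆
cell≡⁅digit⁆ (mkFull 𝒜 _ full) i j =
  -- Fullness is an irrelevant field; decidable equality on ℕ recovers a usable proof of it.
  ⁅the⁆ (𝒜 [ i , j ]) (recompute (∣ 𝒜 [ i , j ] ∣ ≟ⁿ 1) (full i j))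

digit-injective : ∀ {𝒮 𝒮′} → (∀ i j → digit 𝒮 i j ≡ digit 𝒮′ i j) → 𝒮 ≡ 𝒮′
digit-injective {𝒮} {𝒮′} eq = grid-injective (lookup-injective λ i → lookup-injective λ j →
  begin
    grid 𝒮 [ i , j ]   ≡⟨ cell≡⁅digit⁆ 𝒮 i j ⟩
    ⁅ digit 𝒮 i j ⁆    ≡⟨ cong ⁅_⁆ (eq i j) ⟩
    ⁅ digit 𝒮′ i j ⁆   ≡⟨ cell≡⁅digit⁆ 𝒮′ i j ⟨
    grid 𝒮′ [ i , j ]  ∎)
  where
  open ≡-Reasoning
  grid-injective : ∀ {𝒮 𝒮′} → cells (grid 𝒮) ≡ cells (grid 𝒮′) → 𝒮 ≡ 𝒮′
  -- Only the matrices are compared, since all proof fields are irrelevant.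
  grid-injective {mkFull (mkGrid _ _) _ _} {mkFull (mkGrid _ _) _ _} refl = refl

-- Each digit of 𝒮′ lies in the matching cell of 𝒮, a singleton, so it is the digit of 𝒮 there.
⊨ε⇒≡ : ∀ 𝒮 𝒮′ → grid 𝒮 ⊨ ε 𝒮′ → 𝒮′ ≡ 𝒮
⊨ε⇒≡ 𝒮 𝒮′ sat = digit-injective λ i j →
  x∈⁅y⁆⇒x≡y _ (subst (digit 𝒮′ i j ∈ˢ_) (cell≡⁅digit⁆ 𝒮 i j) (digit′∈ i j))
  where
  digit′∈ : ∀ i j → digit 𝒮′ i j ∈ˢ grid 𝒮 [ i , j ]
  digit′∈ i j = ⊨-≈⇒∈ (grid 𝒮) i j (digit 𝒮′ i j)
    (All.lookup
      (⊨-⋀-map⁻ (grid 𝒮) (λ (i , j) → r i c j ≈ digit 𝒮′ i j)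
        (cartesianProduct (allFin 9) (allFin 9)) sat)
      (∈-cartesianProduct⁺ (∈-allFin i) (∈-allFin j)))

theorem9p1 : Uniq ∈ Δax
theorem9p1 𝒮 = ⊨-⋀-map⁺ (λ (𝒮′ , 𝒮″) → ¬ᶠ (ε 𝒮′ ∧ᶠ ε 𝒮″)) (All.map
  (λ { {𝒮′ , 𝒮″} 𝒮′≢𝒮″ (sat′ , sat″) →
       𝒮′≢𝒮″ (trans (⊨ε⇒≡ 𝒮 𝒮′ sat′) (sym (⊨ε⇒≡ 𝒮 𝒮″ sat″))) })
  -- Surviving the filter is what supplies `𝒮′≢𝒮″` for each conjunct.
  (all-filter (λ (𝒮′ , 𝒮″) → ¬? (𝒮′ ≟ 𝒮″)) (cartesianProduct fullSudokuGrids fullSudokuGrids)))
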